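{- For all positive integers $p$ and $d$, $$c_\psi(p,d)=\frac{1}{(d-1)!}\sum_{i=1}^{d}s(d,i)\,J_{i-1}(p),$$ where $c_\psi(p,d)$ is the number of primitive points $x\in\mathbb{Z}^d$ with all coordinates positive and $\|x\|_1=p$.
   Context: A point of $\mathbb{Z}^d$ is primitive if its coordinates are relatively prime. $J_q$ is Jordan's totient function: $J_q(p)=p^q\prod_{n}(1-n^{ -q})$, the product over the primes $n$ dividing $p$ (so $J_0(1)=1$ and $J_0(p)=0$ for $p>1$). $s(d,i)$ are the signed Stirling numbers of the first kind, given by $s(d+1,i)=-d\,s(d,i)+s(d,i-1)$, $s(i,i)=1$, $s(d,0)=0$ for $d>0$. -}

module Defs where

open import Data.Integer as ℤ using (ℤ; +_; -[1+_]; 0ℤ; 1ℤ; ∣_∣)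
import Data.Integer.GCD as ℤ
import Data.Integer.Properties as ℤ
open import Data.List as List using (List; []; _∷_; _++_; filter; length; map; upTo; cartesianProductWith)
open import Data.List.Membership.Propositional using (_∈_)
open import Data.List.Membership.Propositional.Properties
  using (∈-filter⁺; ∈-filter⁻; ∈-upTo⁺; ∈-map⁺; ∈-map⁻; ∈-++⁺ˡ; ∈-++⁺ʳ; ∈-cartesianProductWith⁺)
open import Data.List.Relation.Unary.Any using (here)
open import Data.List.Relation.Unary.Unique.Propositional using (Unique)
import Data.List.Relation.Unary.AllPairs as AllPairs
import Data.List.Relation.Unary.All as ListAll
import Data.List.Relation.Unary.Unique.Propositional.Properties as Unique
open import Data.Nat as ℕ using (ℕ; zero; suc; _≤_; s≤s; NonZero)
open import Data.Nat.Divisibility using (_∣_; _∣?_)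
open import Data.Nat.Primality using (Prime; prime?)
import Data.Nat.Properties as ℕ
open import Data.Product using (_×_; _,_; proj₂)
open import Data.Rational as ℚ using (ℚ; 0ℚ; 1ℚ; _/_)
open import Data.Vec as Vec using (Vec; []; _∷_)
open import Data.Vec.Properties using (∷-injective)
open import Data.Vec.Relation.Unary.All using (All; all?)
open import Function using (_⇔_; mk⇔)
open import Relation.Binary.PropositionalEquality using (_≡_; refl; sym)
open import Relation.Nullary using (Dec)
open import Relation.Nullary.Decidable using (_×-dec_)

private variable
  d : ℕ

fromℕ : ℕ → ℚ
fromℕ n = + n / 1

fromℤ : ℤ → ℚ
fromℤ z = z / 1

sumℚ productℚ : List ℚ → ℚ
sumℚ     = List.foldr ℚ._+_ 0ℚ
productℚ = List.foldr ℚ._*_ 1ℚ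

Σ[1…_] : ℕ → (ℕ → ℚ) → ℚ
Σ[1… n ] f = sumℚ (map (λ k → f (suc k)) (upTo n))

inv! : ℕ → ℚ
inv! n = (1ℤ / (n ℕ.!)) {{n ℕ.!≢0}}

-- n ^ (- q), for n > 0
inv^ : (n q : ℕ) .{{_ : NonZero n}} → ℚ
inv^ n q = (1ℤ / (n ℕ.^ q)) {{ℕ.m^n≢0 n q}}

-- The k < p for which suc k is a prime divisor of p; for p > 0, every
-- prime divisor of p arises in this way exactly once.
primeDivisors-1 : ℕ → List ℕ
primeDivisors-1 p = filter (λ k → prime? (suc k) ×-dec (suc k ∣? p)) (upTo p)

-- J q p is J_q(p), for p > 0.
J : ℕ → ℕ → ℚ
J q p = fromℕ (p ℕ.^ q) ℚ.* productℚ (map (λ k → 1ℚ ℚ.- inv^ (suc k) q) (primeDivisors-1 p))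

-- Row 0 is the boundary row of the recurrence; s i i ≡ 1 is then a
-- consequence (s-diag).
s : ℕ → ℕ → ℤ
s zero    zero    = 1ℤ
s zero    (suc i) = 0ℤ
s (suc d) zero    = 0ℤ
s (suc d) (suc i) = ℤ.- (+ d) ℤ.* s d (suc i) ℤ.+ s d i

s-above : ∀ {d i} → d ℕ.< i → s d i ≡ 0ℤ
s-above {zero}  {suc i} _ = refl
s-above {suc d} {suc i} (s≤s d<i)
  rewrite s-above (ℕ.m<n⇒m<1+n d<i) | s-above d<i | ℤ.*-zeroʳ (ℤ.- (+ d)) = refl

s-diag : ∀ i → s i i ≡ 1ℤ
s-diag zero = refl
s-diag (suc i)
  rewrite s-above (ℕ.n<1+n i) | s-diag i | ℤ.*-zeroʳ (ℤ.- (+ i)) = refl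

content : Vec ℤ d → ℤ
content = Vec.foldr _ ℤ.gcd 0ℤ

Primitive : Vec ℤ d → Set
Primitive x = content x ≡ 1ℤ

‖_‖₁ : Vec ℤ d → ℕ
‖ x ‖₁ = Vec.sum (Vec.map ∣_∣ x)

AllPositive : Vec ℤ d → Set
AllPositive = All (0ℤ ℤ.<_)

IsCounted : ℕ → Vec ℤ d → Set
IsCounted p x = Primitive x × AllPositive x × ‖ x ‖₁ ≡ p

isCounted? : ∀ p (x : Vec ℤ d) → Dec (IsCounted p x)
isCounted? p x = (content x ℤ.≟ 1ℤ) ×-dec all? (0ℤ ℤ.<?_) x ×-dec (‖ x ‖₁ ℕ.≟ p)

interval : ℕ → List ℤ
interval p = map +_ (upTo (suc p)) ++ map -[1+_] (upTo p)

-- The integer points of [-p, p]ᵈ, a box containing every x with ‖ x ‖₁ ≡ p.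
box : ℕ → (d : ℕ) → List (Vec ℤ d)
box p zero    = [] ∷ []
box p (suc d) = cartesianProductWith _∷_ (interval p) (box p d)

countedPoints : ℕ → (d : ℕ) → List (Vec ℤ d)
countedPoints p d = filter (isCounted? p) (box p d)

cψ : ℕ → ℕ → ℕ
cψ p d = length (countedPoints p d)

-- countedPoints p d lists all x with IsCounted p x, without repetition, so
-- its length is the number of such points.

∈-interval : ∀ {p} z → ∣ z ∣ ≤ p → z ∈ interval p
∈-interval (+ n)    n≤p = ∈-++⁺ˡ (∈-map⁺ +_ (∈-upTo⁺ (s≤s n≤p)))
∈-interval -[1+ n ] n<p = ∈-++⁺ʳ (map +_ (upTo _)) (∈-map⁺ -[1+_] (∈-upTo⁺ n<p))

∈-box : ∀ {p} (x : Vec ℤ d) → ‖ x ‖₁ ≤ p → x ∈ box p d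
∈-box []      _ = here refl
∈-box (z ∷ x) h = ∈-cartesianProductWith⁺ _∷_
  (∈-interval z (ℕ.≤-trans (ℕ.m≤m+n ∣ z ∣ ‖ x ‖₁) h))
  (∈-box x (ℕ.≤-trans (ℕ.m≤n+m ‖ x ‖₁ ∣ z ∣) h))

interval-unique : ∀ p → Unique (interval p)
interval-unique p = Unique.++⁺
  (Unique.map⁺ ℤ.+-injective (Unique.upTo⁺ (suc p)))
  (Unique.map⁺ ℤ.-[1+-injective (Unique.upTo⁺ p))
  disjoint
  where
  disjoint : ∀ {z} → z ∈ map +_ (upTo (suc p)) × z ∈ map -[1+_] (upTo p) → _
  disjoint (a , b) with ∈-map⁻ +_ a | ∈-map⁻ -[1+_] b
  ... | _ , _ , refl | _ , _ , ()

box-unique : ∀ p d → Unique (box p d)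
box-unique p zero    = ListAll.[] AllPairs.∷ AllPairs.[]
box-unique p (suc d) =
  Unique.cartesianProductWith⁺ _∷_ ∷-injective (interval-unique p) (box-unique p d)

∈-countedPoints : ∀ {p} {x : Vec ℤ d} → x ∈ countedPoints p d ⇔ IsCounted p x
∈-countedPoints {d} {p} {x} = mk⇔
  (λ x∈ → proj₂ (∈-filter⁻ (isCounted? p) {xs = box p d} x∈))
  (λ c@(_ , _ , ‖x‖≡p) → ∈-filter⁺ (isCounted? p) (∈-box x (ℕ.≤-reflexive ‖x‖≡p)) c)

countedPoints-unique : ∀ p d → Unique (countedPoints p d)
countedPoints-unique p d = Unique.filter⁺ (isCounted? p) (box-unique p d)

{-# OPTIONS --safe #-}
module Submission where

-- For a list L of distinct primes dividing p, count the compositions of p into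
-- d positive parts whose gcd is divisible by no prime of L.  Adjoining a prime n
-- to L removes the compositions n · y with y a composition of p / n of the same
-- kind, which is also how pᵠ ∏ (1 - n^(-q)) changes.  So induction on L reduces
-- the formula to L = [], where the p^(i-1) s(d,i) sum to the falling factorial
-- (p-1)⋯(p-d+1), and C(p-1,d-1) compositions exist.  When L consists of all prime
-- divisors of p, what remains are the primitive points, since the gcd divides p.

open import Defs
open import Data.Nat using (ℕ; NonZero; _∸_)
open import Data.Rational using (_*_)
open import Relation.Binary.PropositionalEquality using (_≡_)

open import Data.Integer as ℤ using (ℤ; +_; 1ℤ; ∣_∣)
import Data.Integer.Properties as ℤ
open import Data.List as List using (List; []; _∷_; _++_; filter; length; map; upTo)
import Data.List.Properties as List
open import Data.List.Membership.Propositional using (_∈_)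
open import Data.List.Membership.Propositional.Properties
  using (∈-filter⁺; ∈-filter⁻; ∈-map⁺; ∈-map⁻; ∈-++⁺ˡ; ∈-++⁺ʳ; ∈-++⁻; ∈-upTo⁺)
open import Data.List.Membership.Propositional.Properties.WithK using (unique∧set⇒bag)
open import Data.List.Relation.Binary.BagAndSetEquality using (∼bag⇒↭)
open import Data.List.Relation.Binary.Disjoint.Propositional using (Disjoint)
open import Data.List.Relation.Binary.Permutation.Propositional.Properties using (↭-length)
open import Data.List.Relation.Unary.All as ListAll using ([]; _∷_)
import Data.List.Relation.Unary.All.Properties as ListAll
open import Data.List.Relation.Unary.AllPairs using ([]; _∷_)
open import Data.List.Relation.Unary.Any using (here)
open import Data.List.Relation.Unary.Unique.Propositional using (Unique)
import Data.List.Relation.Unary.Unique.Propositional.Properties as Unique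
open import Data.Nat as ℕ using (zero; suc; _^_; _!; _<_; z≤n; s≤s)
open import Data.Nat.Divisibility
  using (_∣_; _∤_; _∣?_; _∣0; divides; ∣-trans; m∣m*n; ∣n⇒∣m*n; ∣m∣n⇒∣m+n; ∣⇒≤; 0∣⇒≡0; ∣1⇒≡1)
open import Data.Nat.GCD using (gcd; gcd[m,n]∣m; gcd[m,n]∣n; c*gcd[m,n]≡gcd[cm,cn])
open import Data.Nat.Primality
  using (Prime; euclidsLemma; prime⇒irreducible; ¬prime[1]; ¬prime[0])
open import Data.Nat.Primality.Factorisation using (factorise)
import Data.Nat.Properties as ℕ
open import Data.Nat.Solver using (module +-*-Solver)
open import Data.Product using (_×_; _,_; ∃; proj₁)
open import Data.Rational as ℚ using (ℚ; 0ℚ; 1ℚ; _+_; _-_; -_; _/_)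
import Data.Rational.Properties as ℚ
open import Data.Rational.Solver renaming (module +-*-Solver to ℚ-Solver)
open import Data.Rational.Unnormalised as ℚᵘ using (mkℚᵘ; *≡*)
import Data.Rational.Unnormalised.Properties as ℚᵘ
open import Data.Sum using (inj₁; inj₂; [_,_]′)
open import Data.Vec as Vec using (Vec; []; _∷_)
import Data.Vec.Properties as Vec
open import Data.Vec.Relation.Unary.All as All using (All; []; _∷_)
import Data.Vec.Relation.Unary.All.Properties as All
open import Function using (_⇔_; mk⇔; _∘_; Equivalence)
open import Relation.Binary.PropositionalEquality
  using (_≢_; refl; sym; trans; cong; cong₂; subst; module ≡-Reasoning)
open import Relation.Nullary using (yes; no; contradiction)
open import Relation.Nullary.Decidable using (¬?)
open import Relation.Unary using (Decidable)

-- Integers inside the rationals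

-- `_/_` reduces to lowest terms, which does not compute on variables. The identity is therefore
-- checked on unnormalised fractions, where both sides have denominator 1, and carried back by
-- injectivity of `ℚ.toℚᵘ`.
fromℤ-+ : ∀ a b → fromℤ (a ℤ.+ b) ≡ fromℤ a + fromℤ b
fromℤ-+ a b = ℚ.toℚᵘ-injective (begin
  ℚ.toℚᵘ (fromℤ (a ℤ.+ b))                ≈⟨ ℚ.toℚᵘ-fromℚᵘ (mkℚᵘ (a ℤ.+ b) 0) ⟩
  mkℚᵘ (a ℤ.+ b) 0                        ≈⟨ *≡* (cong (ℤ._* 1ℤ) (sym (cong₂ ℤ._+_ (ℤ.*-identityʳ a) (ℤ.*-identityʳ b)))) ⟩
  mkℚᵘ a 0 ℚᵘ.+ mkℚᵘ b 0                  ≈⟨ ℚᵘ.+-cong (ℚ.toℚᵘ-fromℚᵘ (mkℚᵘ a 0)) (ℚ.toℚᵘ-fromℚᵘ (mkℚᵘ b 0)) ⟨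
  ℚ.toℚᵘ (fromℤ a) ℚᵘ.+ ℚ.toℚᵘ (fromℤ b)  ≈⟨ ℚ.toℚᵘ-homo-+ (fromℤ a) (fromℤ b) ⟨
  ℚ.toℚᵘ (fromℤ a + fromℤ b)              ∎)
  where open ℚᵘ.≃-Reasoning

fromℤ-* : ∀ a b → fromℤ (a ℤ.* b) ≡ fromℤ a * fromℤ b
fromℤ-* a b = ℚ.toℚᵘ-injective (begin
  ℚ.toℚᵘ (fromℤ (a ℤ.* b))                ≈⟨ ℚ.toℚᵘ-fromℚᵘ (mkℚᵘ (a ℤ.* b) 0) ⟩
  mkℚᵘ a 0 ℚᵘ.* mkℚᵘ b 0                  ≈⟨ ℚᵘ.*-cong (ℚ.toℚᵘ-fromℚᵘ (mkℚᵘ a 0)) (ℚ.toℚᵘ-fromℚᵘ (mkℚᵘ b 0)) ⟨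
  ℚ.toℚᵘ (fromℤ a) ℚᵘ.* ℚ.toℚᵘ (fromℤ b)  ≈⟨ ℚ.toℚᵘ-homo-* (fromℤ a) (fromℤ b) ⟨
  ℚ.toℚᵘ (fromℤ a * fromℤ b)              ∎)
  where open ℚᵘ.≃-Reasoning

fromℕ-+ : ∀ a b → fromℕ (a ℕ.+ b) ≡ fromℕ a + fromℕ b
fromℕ-+ a b = trans (cong fromℤ (ℤ.pos-+ a b)) (fromℤ-+ (+ a) (+ b))

fromℕ-* : ∀ a b → fromℕ (a ℕ.* b) ≡ fromℕ a * fromℕ b
fromℕ-* a b = trans (cong fromℤ (ℤ.pos-* a b)) (fromℤ-* (+ a) (+ b))

fromℕ-*-1/ : ∀ n .{{_ : NonZero n}} → fromℕ n * (1ℤ / n) ≡ 1ℚ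
fromℕ-*-1/ n@(suc k) = ℚ.toℚᵘ-injective (begin
  ℚ.toℚᵘ (fromℕ n * (1ℤ / n))                ≈⟨ ℚ.toℚᵘ-homo-* (fromℕ n) (1ℤ / n) ⟩
  ℚ.toℚᵘ (fromℕ n) ℚᵘ.* ℚ.toℚᵘ (1ℤ / n)      ≈⟨ ℚᵘ.*-cong (ℚ.toℚᵘ-fromℚᵘ (mkℚᵘ (+ n) 0)) (ℚ.toℚᵘ-fromℚᵘ (mkℚᵘ 1ℤ k)) ⟩
  mkℚᵘ (+ n) 0 ℚᵘ.* mkℚᵘ 1ℤ k                ≈⟨ *≡* numerators≡ ⟩
  mkℚᵘ 1ℤ 0                                  ∎)
  where
  open ℚᵘ.≃-Reasoning
  numerators≡ : + n ℤ.* 1ℤ ℤ.* 1ℤ ≡ 1ℤ ℤ.* + (1 ℕ.* n)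
  numerators≡ = trans (ℤ.*-identityʳ (+ n ℤ.* 1ℤ)) (trans (ℤ.*-identityʳ (+ n))
    (sym (trans (ℤ.*-identityˡ (+ (1 ℕ.* n))) (cong (λ z → + z) (ℕ.*-identityˡ n)))))

open ≡-Reasoning

fromℤ-neg : ∀ a → fromℤ (ℤ.- a) ≡ - fromℤ a
fromℤ-neg a = begin
  fromℤ (ℤ.- a)                            ≡⟨ solve 2 (λ x y → x := (x :+ y) :- y) refl (fromℤ (ℤ.- a)) (fromℤ a) ⟩
  (fromℤ (ℤ.- a) + fromℤ a) - fromℤ a      ≡⟨ cong (_- fromℤ a) (fromℤ-+ (ℤ.- a) a) ⟨
  fromℤ (ℤ.- a ℤ.+ a) - fromℤ a            ≡⟨ cong (λ z → fromℤ z - fromℤ a) (ℤ.+-inverseˡ a) ⟩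
  0ℚ - fromℤ a                             ≡⟨ ℚ.+-identityˡ (- fromℤ a) ⟩
  - fromℤ a                                ∎
  where open ℚ-Solver

-- Finite sums of rationals

sumℚ-*ˡ : ∀ {A : Set} c (f : A → ℚ) xs → sumℚ (map (λ x → c * f x) xs) ≡ c * sumℚ (map f xs)
sumℚ-*ˡ c f []       = sym (ℚ.*-zeroʳ c)
sumℚ-*ˡ c f (x ∷ xs) = trans (cong (λ z → c * f x + z) (sumℚ-*ˡ c f xs)) (sym (ℚ.*-distribˡ-+ c (f x) _))

sumℚ-+ : ∀ {A : Set} (f g : A → ℚ) xs →
  sumℚ (map (λ x → f x + g x) xs) ≡ sumℚ (map f xs) + sumℚ (map g xs)
sumℚ-+ f g []       = refl
sumℚ-+ f g (x ∷ xs) = trans (cong (λ z → f x + g x + z) (sumℚ-+ f g xs))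
  (solve 4 (λ a b c d → a :+ b :+ (c :+ d) := a :+ c :+ (b :+ d)) refl (f x) (g x) _ _)
  where open ℚ-Solver

sumℚ-∷ʳ : ∀ xs y → sumℚ (xs List.∷ʳ y) ≡ sumℚ xs + y
sumℚ-∷ʳ []       y = ℚ.+-comm y 0ℚ
sumℚ-∷ʳ (x ∷ xs) y = trans (cong (λ z → x + z) (sumℚ-∷ʳ xs y)) (sym (ℚ.+-assoc x _ y))

Σ-cong : ∀ n (f g : ℕ → ℚ) → (∀ k → f (suc k) ≡ g (suc k)) → Σ[1… n ] f ≡ Σ[1… n ] g
Σ-cong n f g f≗g = cong sumℚ (List.map-cong f≗g (upTo n))

Σ-last : ∀ n f → Σ[1… suc n ] f ≡ Σ[1… n ] f + f (suc n)
Σ-last n f = begin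
  sumℚ (map f′ (upTo (suc n)))          ≡⟨ cong (sumℚ ∘ map f′) (List.upTo-∷ʳ n) ⟨
  sumℚ (map f′ (upTo n List.∷ʳ n))      ≡⟨ cong sumℚ (List.map-++ f′ (upTo n) (n ∷ [])) ⟩
  sumℚ (map f′ (upTo n) List.∷ʳ f′ n)   ≡⟨ sumℚ-∷ʳ (map f′ (upTo n)) (f′ n) ⟩
  sumℚ (map f′ (upTo n)) + f′ n         ∎
  where f′ = f ∘ suc

Σ-first : ∀ n f → Σ[1… suc n ] f ≡ f 1 + Σ[1… n ] (f ∘ suc)
Σ-first n f = cong (λ xs → f 1 + sumℚ xs)
  (trans (List.map-applyUpTo suc (f ∘ suc) n) (sym (List.map-upTo (f ∘ suc ∘ suc) n)))

-- Stirling numbers and falling factorials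

-- For positive `d` this is (x-1)(x-2)⋯(x-d+1): the falling factorial of `x` with its factor `x`
-- cancelled, which explains the exponent `i ∸ 1`.
stirlingSum : ℕ → ℕ → ℚ
stirlingSum d x = Σ[1… d ] (λ i → fromℤ (s d i) * fromℕ (x ^ (i ∸ 1)))

-- The recurrence of `s` splits each term in two. The part with coefficient `- D` reproduces the sum
-- for `d`; the part with the lowered index reproduces it shifted by one power, hence multiplied by
-- `x`.
stirlingSum-suc : ∀ e x →
  stirlingSum (suc (suc e)) x ≡ (fromℕ x - fromℕ (suc e)) * stirlingSum (suc e) x
stirlingSum-suc e x = begin
  Σ[1… suc d ] (λ i → fromℤ (s (suc d) i) * pow (i ∸ 1))
    ≡⟨ Σ-cong (suc d) (λ i → fromℤ (s (suc d) i) * pow (i ∸ 1)) (λ i → - D * a i + b i) split ⟩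
  Σ[1… suc d ] (λ i → - D * a i + b i)
    ≡⟨ sumℚ-+ (λ k → - D * a (suc k)) (λ k → b (suc k)) (upTo (suc d)) ⟩
  Σ[1… suc d ] (λ i → - D * a i) + Σ[1… suc d ] b
    ≡⟨ cong₂ _+_ (sumℚ-*ˡ (- D) (λ k → a (suc k)) (upTo (suc d))) (Σ-first d b) ⟩
  - D * Σ[1… suc d ] a + (b 1 + Σ[1… d ] (b ∘ suc))
    ≡⟨ cong₂ (λ u v → - D * u + (b 1 + v)) dropLast shift ⟩
  -- `b 1` is `0ℚ * 1ℚ` because `s d 0` vanishes by definition once `d` is a successor.
  - D * Σ[1… d ] a + (0ℚ * 1ℚ + X * Σ[1… d ] a)
    ≡⟨ solve 3 (λ D X S → :- D :* S :+ (con 0ℚ :* con 1ℚ :+ X :* S) := (X :- D) :* S) refl D X (Σ[1… d ] a) ⟩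
  (X - D) * Σ[1… d ] a ∎
  where
  open ℚ-Solver
  d = suc e
  D = fromℕ d
  X = fromℕ x
  pow a b : ℕ → ℚ
  pow q = fromℕ (x ^ q)
  a i = fromℤ (s d i) * pow (i ∸ 1)
  b i = fromℤ (s d (i ∸ 1)) * pow (i ∸ 1)
  split : ∀ k → fromℤ (s (suc d) (suc k)) * pow k ≡ - D * a (suc k) + b (suc k)
  split k = begin
    fromℤ (ℤ.- (+ d) ℤ.* s d (suc k) ℤ.+ s d k) * pow k
      ≡⟨ cong (_* pow k) (trans (fromℤ-+ (ℤ.- (+ d) ℤ.* s d (suc k)) (s d k))
           (cong (_+ fromℤ (s d k)) (trans (fromℤ-* (ℤ.- (+ d)) (s d (suc k)))
             (cong (_* fromℤ (s d (suc k))) (fromℤ-neg (+ d)))))) ⟩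
    (- D * fromℤ (s d (suc k)) + fromℤ (s d k)) * pow k
      ≡⟨ solve 4 (λ D u v w → (:- D :* u :+ v) :* w := :- D :* (u :* w) :+ v :* w) refl D _ _ (pow k) ⟩
    - D * a (suc k) + b (suc k) ∎
  dropLast : Σ[1… suc d ] a ≡ Σ[1… d ] a
  dropLast = begin
    Σ[1… suc d ] a            ≡⟨ Σ-last d a ⟩
    Σ[1… d ] a + a (suc d)    ≡⟨ cong (λ z → Σ[1… d ] a + fromℤ z * pow d) (s-above (ℕ.n<1+n d)) ⟩
    Σ[1… d ] a + 0ℚ * pow d   ≡⟨ solve 2 (λ u v → u :+ con 0ℚ :* v := u) refl (Σ[1… d ] a) (pow d) ⟩
    Σ[1… d ] a                ∎
  shift : Σ[1… d ] (b ∘ suc) ≡ X * Σ[1… d ] a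
  shift = trans
    (Σ-cong d (b ∘ suc) (λ i → X * a i) (λ k → trans
      (cong (fromℤ (s d (suc k)) *_) (fromℕ-* x (x ^ k)))
      (solve 3 (λ u v w → u :* (v :* w) := v :* (u :* w)) refl (fromℤ (s d (suc k))) X (pow k))))
    (sumℚ-*ˡ X (λ k → a (suc k)) (upTo d))

-- Compositions

private variable
  d m n : ℕ

incrementHead : Vec ℕ (suc d) → Vec ℕ (suc d)
incrementHead (x ∷ xs) = suc x ∷ xs

-- A composition of `suc n` either starts with 1, or comes from a composition of `n` by enlarging
-- its first part. The two lists are thus already arranged for Pascal's rule.
compositions : ℕ → (d : ℕ) → List (Vec ℕ d)
compositions zero    zero    = [] ∷ []
compositions zero    (suc d) = []
compositions (suc n) zero    = []
compositions (suc n) (suc d) =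
  map (1 ∷_) (compositions n d) ++ map incrementHead (compositions n (suc d))

IsComposition : ℕ → Vec ℕ d → Set
IsComposition n x = All (0 <_) x × Vec.sum x ≡ n

∈-compositions⁻ : ∀ n {x : Vec ℕ d} → x ∈ compositions n d → IsComposition n x
∈-compositions⁻ {zero}  zero    (here refl) = [] , refl
∈-compositions⁻ {suc d} (suc n) x∈ with ∈-++⁻ (map (1 ∷_) (compositions n d)) x∈
... | inj₁ h with ∈-map⁻ (1 ∷_) h
...   | y , y∈ , refl with ∈-compositions⁻ n y∈
...     | pos , refl = s≤s z≤n ∷ pos , refl
∈-compositions⁻ {suc d} (suc n) x∈ | inj₂ h with ∈-map⁻ incrementHead h
...   | y ∷ ys , y∈ , refl with ∈-compositions⁻ n y∈
...     | _ ∷ pos , refl = s≤s z≤n ∷ pos , refl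

∈-compositions⁺ : ∀ n {x : Vec ℕ d} → IsComposition n x → x ∈ compositions n d
∈-compositions⁺ zero    {[]}             _                = here refl
∈-compositions⁺ (suc n) {1 ∷ xs}         (_ ∷ pos , refl) =
  ∈-++⁺ˡ (∈-map⁺ (1 ∷_) (∈-compositions⁺ n (pos , refl)))
∈-compositions⁺ {suc d} (suc n) {suc (suc x) ∷ xs} (_ ∷ pos , refl) =
  ∈-++⁺ʳ (map (1 ∷_) (compositions n d))
    (∈-map⁺ incrementHead (∈-compositions⁺ n {suc x ∷ xs} (s≤s z≤n ∷ pos , refl)))
∈-compositions⁺ zero    {zero ∷ xs}  (() ∷ _ , _)
∈-compositions⁺ zero    {suc x ∷ xs} (_ , ())
∈-compositions⁺ (suc n) {[]}         (_ , ())
∈-compositions⁺ (suc n) {zero ∷ xs}  (() ∷ _ , _)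

compositions-unique : ∀ n d → Unique (compositions n d)
compositions-unique zero    zero    = [] ∷ []
compositions-unique zero    (suc d) = []
compositions-unique (suc n) zero    = []
compositions-unique (suc n) (suc d) = Unique.++⁺
  (Unique.map⁺ Vec.∷-injectiveʳ (compositions-unique n d))
  (Unique.map⁺ incrementHead-injective (compositions-unique n (suc d)))
  disjoint
  where
  incrementHead-injective : ∀ {x y : Vec ℕ (suc d)} → incrementHead x ≡ incrementHead y → x ≡ y
  incrementHead-injective {x ∷ xs} {y ∷ ys} refl = refl
  disjoint : Disjoint (map (1 ∷_) (compositions n d)) (map incrementHead (compositions n (suc d)))
  disjoint (h , h′) with ∈-map⁻ (1 ∷_) h | ∈-map⁻ incrementHead h′
  -- A common element starts with 1, so before incrementing its head was 0, which positivity of the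
  -- parts forbids.
  ... | _ , _ , refl | zero ∷ _ , y∈ , refl with ∈-compositions⁻ n y∈
  ...   | () ∷ _ , _

#compositions : ℕ → ℕ → ℕ
#compositions n d = length (compositions n d)

#compositions-pascal : ∀ n d →
  #compositions (suc n) (suc d) ≡ #compositions n d ℕ.+ #compositions n (suc d)
#compositions-pascal n d = begin
  length (map (1 ∷_) (compositions n d) ++ map incrementHead (compositions n (suc d)))
    ≡⟨ List.length-++ (map (1 ∷_) (compositions n d)) ⟩
  length (map (1 ∷_) (compositions n d)) ℕ.+ length (map incrementHead (compositions n (suc d)))
    ≡⟨ cong₂ ℕ._+_ (List.length-map (1 ∷_) (compositions n d))
                   (List.length-map incrementHead (compositions n (suc d))) ⟩
  #compositions n d ℕ.+ #compositions n (suc d) ∎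

#compositions-1 : ∀ n → #compositions (suc n) 1 ≡ 1
#compositions-1 zero    = refl
#compositions-1 (suc n) = trans (#compositions-pascal (suc n) 0) (#compositions-1 n)

-- Reading `#compositions (suc n) (suc e)` as C(n,e), this is the absorption identity (e+1)
-- C(n+1,e+1) = (n+1) C(n,e). Pascal's rule expands the left side, the induction hypotheses apply in
-- two neighbouring columns, and Pascal's rule recombines the results.
#compositions-absorption : ∀ n e →
  suc e ℕ.* #compositions (suc (suc n)) (suc (suc e)) ≡ suc n ℕ.* #compositions (suc n) (suc e)
#compositions-absorption zero zero = refl
-- Both counts compute to 0, there being more parts than units; what is left of the product is
-- `e ℕ.* 0`.
#compositions-absorption zero (suc e) = trans (cong (suc (suc e) ℕ.*_) {y = 0} refl) (ℕ.*-zeroʳ e)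
-- There is no column to the left for an induction hypothesis here; that column of counts is
-- constantly 1 instead.
#compositions-absorption (suc n) zero = begin
  1 ℕ.* #compositions (suc (suc (suc n))) 2  ≡⟨ ℕ.*-identityˡ _ ⟩
  #compositions (suc (suc (suc n))) 2        ≡⟨ #compositions-pascal (suc (suc n)) 1 ⟩
  #compositions (suc (suc n)) 1 ℕ.+ #compositions (suc (suc n)) 2
    ≡⟨ cong₂ ℕ._+_ (#compositions-1 (suc n)) (sym (ℕ.*-identityˡ _)) ⟩
  1 ℕ.+ 1 ℕ.* #compositions (suc (suc n)) 2
    ≡⟨ cong suc (#compositions-absorption n 0) ⟩
  1 ℕ.+ suc n ℕ.* #compositions (suc n) 1
    ≡⟨ cong (λ z → 1 ℕ.+ suc n ℕ.* z) (#compositions-1 n) ⟩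
  suc (suc n) ℕ.* 1
    ≡⟨ cong (suc (suc n) ℕ.*_) (#compositions-1 (suc n)) ⟨
  suc (suc n) ℕ.* #compositions (suc (suc n)) 1 ∎
#compositions-absorption (suc n) (suc e) = begin
  suc (suc e) ℕ.* #compositions (suc (suc (suc n))) (suc (suc (suc e)))
    ≡⟨ cong (suc (suc e) ℕ.*_) (#compositions-pascal (suc (suc n)) (suc (suc e))) ⟩
  suc (suc e) ℕ.* (u ℕ.+ v)
    ≡⟨ solve 3 (λ e u v → (con 2 :+ e) :* (u :+ v) := u :+ (con 1 :+ e) :* u :+ (con 2 :+ e) :* v) refl e u v ⟩
  u ℕ.+ suc e ℕ.* u ℕ.+ suc (suc e) ℕ.* v
    ≡⟨ cong₂ (λ y z → u ℕ.+ y ℕ.+ z) (#compositions-absorption n e) (#compositions-absorption n (suc e)) ⟩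
  u ℕ.+ suc n ℕ.* #compositions (suc n) (suc e) ℕ.+ suc n ℕ.* #compositions (suc n) (suc (suc e))
    ≡⟨ trans (ℕ.+-assoc u _ _) (cong (u ℕ.+_) (sym (ℕ.*-distribˡ-+ (suc n) (#compositions (suc n) (suc e)) _))) ⟩
  u ℕ.+ suc n ℕ.* (#compositions (suc n) (suc e) ℕ.+ #compositions (suc n) (suc (suc e)))
    ≡⟨ cong (λ z → u ℕ.+ suc n ℕ.* z) (#compositions-pascal (suc n) (suc e)) ⟨
  suc (suc n) ℕ.* u ∎
  where
  open +-*-Solver
  u = #compositions (suc (suc n)) (suc (suc e))
  v = #compositions (suc (suc n)) (suc (suc (suc e)))

-- This is (e+1) C(n,e+1) = (n-e) C(n,e), rearranged to avoid truncated subtraction. Pascal's rule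
-- merges the two left-hand terms, and absorption finishes.
#compositions-ratio : ∀ n e →
  suc e ℕ.* #compositions (suc n) (suc (suc e)) ℕ.+ suc e ℕ.* #compositions (suc n) (suc e)
    ≡ suc n ℕ.* #compositions (suc n) (suc e)
#compositions-ratio n e = begin
  suc e ℕ.* b ℕ.+ suc e ℕ.* a                      ≡⟨ ℕ.+-comm (suc e ℕ.* b) _ ⟩
  suc e ℕ.* a ℕ.+ suc e ℕ.* b                      ≡⟨ ℕ.*-distribˡ-+ (suc e) a b ⟨
  suc e ℕ.* (a ℕ.+ b)                              ≡⟨ cong (suc e ℕ.*_) (#compositions-pascal (suc n) (suc e)) ⟨
  suc e ℕ.* #compositions (suc (suc n)) (suc (suc e)) ≡⟨ #compositions-absorption n e ⟩
  suc n ℕ.* a                                      ∎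
  where
  a = #compositions (suc n) (suc e)
  b = #compositions (suc n) (suc (suc e))

-- Both sides are n(n-1)⋯(n-e+1). Passing from `e` to `suc e` multiplies each by (n+1)-(e+1): the
-- left by `#compositions-ratio`, the right by `stirlingSum-suc`.
!*#compositions≡stirlingSum : ∀ n e →
  fromℕ (e !) * fromℕ (#compositions (suc n) (suc e)) ≡ stirlingSum (suc e) (suc n)
!*#compositions≡stirlingSum n zero = cong (λ z → 1ℚ * fromℕ z) (#compositions-1 n)
!*#compositions≡stirlingSum n (suc e) = begin
  fromℕ (suc e ℕ.* e !) * b
    ≡⟨ cong (_* b) (fromℕ-* (suc e) (e !)) ⟩
  E * F * b
    ≡⟨ solve 4 (λ E F a b → E :* F :* b := F :* ((E :* b :+ E :* a) :- E :* a)) refl E F a b ⟩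
  -- `E * a` is added and subtracted to expose the left side of the subtraction-free ratio.
  F * ((E * b + E * a) - E * a)
    ≡⟨ cong (λ z → F * (z - E * a)) ratio ⟩
  F * (N * a - E * a)
    ≡⟨ solve 4 (λ E F N a → F :* (N :* a :- E :* a) := (N :- E) :* (F :* a)) refl E F N a ⟩
  (N - E) * (F * a)
    ≡⟨ cong ((N - E) *_) (!*#compositions≡stirlingSum n e) ⟩
  (N - E) * stirlingSum (suc e) (suc n)
    ≡⟨ stirlingSum-suc e (suc n) ⟨
  stirlingSum (suc (suc e)) (suc n) ∎
  where
  open ℚ-Solver
  a′ = #compositions (suc n) (suc e)
  b′ = #compositions (suc n) (suc (suc e))
  E = fromℕ (suc e)
  F = fromℕ (e !)
  N = fromℕ (suc n)
  a = fromℕ a′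
  b = fromℕ b′
  ratio : E * b + E * a ≡ N * a
  ratio = begin
    E * b + E * a                                    ≡⟨ cong₂ _+_ (fromℕ-* (suc e) b′) (fromℕ-* (suc e) a′) ⟨
    fromℕ (suc e ℕ.* b′) + fromℕ (suc e ℕ.* a′)      ≡⟨ fromℕ-+ (suc e ℕ.* b′) (suc e ℕ.* a′) ⟨
    fromℕ (suc e ℕ.* b′ ℕ.+ suc e ℕ.* a′)            ≡⟨ cong fromℕ (#compositions-ratio n e) ⟩
    fromℕ (suc n ℕ.* a′)                             ≡⟨ fromℕ-* (suc n) a′ ⟩
    N * a                                            ∎

-- Removing the points divisible by a prime

gcdᵛ : Vec ℕ d → ℕ
gcdᵛ = Vec.foldr _ gcd 0

gcdᵛ∣sum : ∀ (x : Vec ℕ d) → gcdᵛ x ∣ Vec.sum x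
gcdᵛ∣sum []       = 0 ∣0
gcdᵛ∣sum (x ∷ xs) = ∣m∣n⇒∣m+n (gcd[m,n]∣m x (gcdᵛ xs))
  (∣-trans (gcd[m,n]∣n x (gcdᵛ xs)) (gcdᵛ∣sum xs))

scale : ℕ → Vec ℕ d → Vec ℕ d
scale n = Vec.map (n ℕ.*_)

gcdᵛ-scale : ∀ n (x : Vec ℕ d) → gcdᵛ (scale n x) ≡ n ℕ.* gcdᵛ x
gcdᵛ-scale n []       = sym (ℕ.*-zeroʳ n)
gcdᵛ-scale n (x ∷ xs) = trans (cong (gcd (n ℕ.* x)) (gcdᵛ-scale n xs))
  (sym (c*gcd[m,n]≡gcd[cm,cn] n x (gcdᵛ xs)))

sum-scale : ∀ n (x : Vec ℕ d) → Vec.sum (scale n x) ≡ n ℕ.* Vec.sum x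
sum-scale n []       = sym (ℕ.*-zeroʳ n)
sum-scale n (x ∷ xs) = trans (cong ((n ℕ.* x) ℕ.+_) (sum-scale n xs)) (sym (ℕ.*-distribˡ-+ n x _))

∣gcdᵛ⇒scale : ∀ n (x : Vec ℕ d) → n ∣ gcdᵛ x → ∃ λ y → x ≡ scale n y
∣gcdᵛ⇒scale n []       _ = [] , refl
∣gcdᵛ⇒scale n (x ∷ xs) h
  with ∣-trans h (gcd[m,n]∣m x (gcdᵛ xs)) | ∣gcdᵛ⇒scale n xs (∣-trans h (gcd[m,n]∣n x (gcdᵛ xs)))
... | divides q refl | ys , refl = q ∷ ys , cong (_∷ scale n ys) (ℕ.*-comm q n)

mapᵛ-injective : ∀ {A B : Set} {f : A → B} → (∀ {x y} → f x ≡ f y → x ≡ y) →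
  {xs ys : Vec A d} → Vec.map f xs ≡ Vec.map f ys → xs ≡ ys
mapᵛ-injective f-inj {[]}     {[]}     _  = refl
mapᵛ-injective f-inj {_ ∷ _} {_ ∷ _} eq =
  cong₂ _∷_ (f-inj (Vec.∷-injectiveˡ eq)) (mapᵛ-injective f-inj (Vec.∷-injectiveʳ eq))

scale-injective : ∀ n .{{_ : NonZero n}} {x y : Vec ℕ d} → scale n x ≡ scale n y → x ≡ y
scale-injective n = mapᵛ-injective (λ {a} {b} → ℕ.*-cancelˡ-≡ a b n)

0<*⁻ʳ : ∀ n {x} → 0 < n ℕ.* x → 0 < x
0<*⁻ʳ n {zero}  h = contradiction (subst (0 <_) (ℕ.*-zeroʳ n) h) λ ()
0<*⁻ʳ n {suc x} _ = s≤s z≤n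

0<*⁺ʳ : ∀ n .{{_ : NonZero n}} {x} → 0 < x → 0 < n ℕ.* x
0<*⁺ʳ n {suc x} _ = ℕ.>-nonZero⁻¹ (n ℕ.* suc x) {{ℕ.m*n≢0 n (suc x)}}

scale-isComposition : ∀ m n .{{_ : NonZero n}} (x : Vec ℕ d) →
  IsComposition m x ⇔ IsComposition (m ℕ.* n) (scale n x)
scale-isComposition m n x = mk⇔
  (λ (pos , sum≡) → All.map⁺ (All.map (0<*⁺ʳ n) pos) ,
    trans (sum-scale n x) (trans (cong (n ℕ.*_) sum≡) (ℕ.*-comm n m)))
  (λ (pos , sum≡) → All.map (0<*⁻ʳ n) (All.map⁻ pos) ,
    ℕ.*-cancelˡ-≡ _ _ n (trans (sym (sum-scale n x)) (trans sum≡ (ℕ.*-comm m n))))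

-- As in primeDivisors-1, an entry k of a list of primes stands for suc k.

PrimeDivisorOf : ℕ → ℕ → Set
PrimeDivisorOf n k = Prime (suc k) × suc k ∣ n

Free : List ℕ → Vec ℕ d → Set
Free L x = ListAll.All (λ k → suc k ∤ gcdᵛ x) L

free? : ∀ L → Decidable (Free {d} L)
free? L x = ListAll.all? (λ k → ¬? (suc k ∣? gcdᵛ x)) L

freeCompositions : List ℕ → ℕ → (d : ℕ) → List (Vec ℕ d)
freeCompositions L n d = filter (free? L) (compositions n d)

freeCompositions-unique : ∀ L n d → Unique (freeCompositions L n d)
freeCompositions-unique L n d = Unique.filter⁺ (free? L) (compositions-unique n d)

∈-freeCompositions : ∀ L n {x : Vec ℕ d} →
  x ∈ freeCompositions L n d ⇔ (IsComposition n x × Free L x)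
∈-freeCompositions {d} L n = mk⇔
  (λ h → let x∈ , free = ∈-filter⁻ (free? L) {xs = compositions n d} h in ∈-compositions⁻ n x∈ , free)
  (λ (comp , free) → ∈-filter⁺ (free? L) (∈-compositions⁺ n comp) free)

prime∣prime⇒≡ : ∀ {p q} → Prime p → Prime q → p ∣ q → p ≡ q
prime∣prime⇒≡ p-prime q-prime p∣q with prime⇒irreducible q-prime p∣q
... | inj₁ refl = contradiction p-prime ¬prime[1]
... | inj₂ p≡q  = p≡q

-- Euclid's lemma, with the other alternative excluded by distinctness. It serves twice: scaling by
-- one prime creates no divisibility by another, and dividing by one prime keeps the others as
-- divisors.
distinctPrimes⇒∣ : ∀ {j k} m → Prime (suc j) → Prime (suc k) → k ≢ j → suc j ∣ suc k ℕ.* m → suc j ∣ m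
distinctPrimes⇒∣ {j} {k} m j-prime k-prime k≢j h with euclidsLemma (suc k) m j-prime h
... | inj₁ j∣k = contradiction (sym (ℕ.suc-injective (prime∣prime⇒≡ j-prime k-prime j∣k))) k≢j
... | inj₂ j∣m = j∣m

-- Duplicate-free lists with the same elements are permutations of each other, so counts can be
-- compared through membership alone.
length-≡ : ∀ {A : Set} {xs ys : List A} → Unique xs → Unique ys →
  (∀ {x} → x ∈ xs → x ∈ ys) → (∀ {x} → x ∈ ys → x ∈ xs) → length xs ≡ length ys
length-≡ xs! ys! to from = ↭-length (∼bag⇒↭ (unique∧set⇒bag xs! ys! (mk⇔ to from)))

-- The `L`-free compositions are split by whether the new prime divides their gcd. Those it does not
-- divide are free for `k ∷ L`; the others are exactly the multiples by `suc k` of `L`-free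
-- compositions of `m`, since `suc k` differs from the primes of `L`.
length-freeCompositions-∷ : ∀ k L m d →
  Prime (suc k) → ListAll.All (Prime ∘ suc) L → ListAll.All (k ≢_) L →
  length (freeCompositions L (m ℕ.* suc k) d) ≡
  length (freeCompositions (k ∷ L) (m ℕ.* suc k) d) ℕ.+ length (freeCompositions L m d)
length-freeCompositions-∷ k L m d k-prime L-prime k∉L = begin
  length (freeCompositions L (m ℕ.* p) d)
    ≡⟨ length-≡ (freeCompositions-unique L (m ℕ.* p) d) (Unique.++⁺
         (freeCompositions-unique (k ∷ L) (m ℕ.* p) d)
         (Unique.map⁺ (scale-injective p) (freeCompositions-unique L m d)) disjoint)
         split ([ weaken , scaled ]′ ∘ ∈-++⁻ (freeCompositions (k ∷ L) (m ℕ.* p) d)) ⟩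
  length (freeCompositions (k ∷ L) (m ℕ.* p) d ++ map (scale p) (freeCompositions L m d))
    ≡⟨ List.length-++ (freeCompositions (k ∷ L) (m ℕ.* p) d) ⟩
  length (freeCompositions (k ∷ L) (m ℕ.* p) d) ℕ.+ length (map (scale p) (freeCompositions L m d))
    ≡⟨ cong (length (freeCompositions (k ∷ L) (m ℕ.* p) d) ℕ.+_) (List.length-map (scale p) (freeCompositions L m d)) ⟩
  length (freeCompositions (k ∷ L) (m ℕ.* p) d) ℕ.+ length (freeCompositions L m d) ∎
  where
  open Equivalence
  p = suc k
  p∣gcdᵛ-scale : ∀ (y : Vec ℕ d) → p ∣ gcdᵛ (scale p y)
  p∣gcdᵛ-scale y = subst (p ∣_) (sym (gcdᵛ-scale p y)) (m∣m*n (gcdᵛ y))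
  free-scale⁺ : ∀ (y : Vec ℕ d) → Free L y → Free L (scale p y)
  free-scale⁺ y free = ListAll.zipWith
    (λ ((j-prime , k≢j) , j∤y) j∣py →
      j∤y (distinctPrimes⇒∣ (gcdᵛ y) j-prime k-prime k≢j (subst (_ ∣_) (gcdᵛ-scale p y) j∣py)))
    (ListAll.zip (L-prime , k∉L) , free)
  free-scale⁻ : ∀ (y : Vec ℕ d) → Free L (scale p y) → Free L y
  free-scale⁻ y = ListAll.map λ j∤py j∣y → j∤py (subst (_ ∣_) (sym (gcdᵛ-scale p y)) (∣n⇒∣m*n p j∣y))
  split : ∀ {x} → x ∈ freeCompositions L (m ℕ.* p) d →
    x ∈ freeCompositions (k ∷ L) (m ℕ.* p) d ++ map (scale p) (freeCompositions L m d)
  split {x} x∈ with ∈-freeCompositions L (m ℕ.* p) .to x∈ | p ∣? gcdᵛ x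
  ... | comp , free | no p∤x = ∈-++⁺ˡ (∈-freeCompositions (k ∷ L) (m ℕ.* p) .from (comp , p∤x ∷ free))
  ... | comp , free | yes p∣x with ∣gcdᵛ⇒scale p x p∣x
  ...   | y , refl = ∈-++⁺ʳ (freeCompositions (k ∷ L) (m ℕ.* p) d) (∈-map⁺ (scale p)
            (∈-freeCompositions L m .from (scale-isComposition m p y .from comp , free-scale⁻ y free)))
  weaken : ∀ {x} → x ∈ freeCompositions (k ∷ L) (m ℕ.* p) d → x ∈ freeCompositions L (m ℕ.* p) d
  weaken x∈ with ∈-freeCompositions (k ∷ L) (m ℕ.* p) .to x∈
  ... | comp , _ ∷ free = ∈-freeCompositions L (m ℕ.* p) .from (comp , free)
  scaled : ∀ {x} → x ∈ map (scale p) (freeCompositions L m d) → x ∈ freeCompositions L (m ℕ.* p) d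
  scaled x∈ with ∈-map⁻ (scale p) x∈
  ... | y , y∈ , refl with ∈-freeCompositions L m .to y∈
  ...   | comp , free = ∈-freeCompositions L (m ℕ.* p) .from (scale-isComposition m p y .to comp , free-scale⁺ y free)
  disjoint : Disjoint (freeCompositions (k ∷ L) (m ℕ.* p) d) (map (scale p) (freeCompositions L m d))
  disjoint (h , h′) with ∈-freeCompositions (k ∷ L) (m ℕ.* p) .to h | ∈-map⁻ (scale p) h′
  ... | _ , p∤x ∷ _ | y , _ , refl = p∤x (p∣gcdᵛ-scale y)

-- Partial Jordan totients

^-distribʳ-* : ∀ a b q → (a ℕ.* b) ^ q ≡ a ^ q ℕ.* b ^ q
^-distribʳ-* a b zero    = refl
^-distribʳ-* a b (suc q) = trans (cong (a ℕ.* b ℕ.*_) (^-distribʳ-* a b q))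
  (solve 4 (λ a b u v → a :* b :* (u :* v) := a :* u :* (b :* v)) refl a b (a ^ q) (b ^ q))
  where open +-*-Solver

eulerProduct : ℕ → List ℕ → ℚ
eulerProduct q L = productℚ (map (λ k → 1ℚ - inv^ (suc k) q) L)

-- The list is independent of `n`, so that it can stay fixed while `n` is replaced by its quotient
-- by a prime.
partialJ : List ℕ → ℕ → ℕ → ℚ
partialJ L q n = fromℕ (n ^ q) * eulerProduct q L

-- Expanding the new Euler factor leaves (m(k+1))^q (k+1)^(-q) = m^q. The difference is written with
-- the scalar `- 1ℚ` to suit `sumℚ-+` and `sumℚ-*ˡ`.
partialJ-∷ : ∀ k L q m →
  partialJ (k ∷ L) q (m ℕ.* suc k) ≡ partialJ L q (m ℕ.* suc k) + - 1ℚ * partialJ L q m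
partialJ-∷ k L q m = begin
  P * ((1ℚ - I) * E)                 ≡⟨ solve 3 (λ P I E → P :* ((con 1ℚ :- I) :* E) := P :* E :- (P :* I) :* E) refl P I E ⟩
  P * E - (P * I) * E                ≡⟨ cong (λ z → P * E - z * E) cancel ⟩
  P * E - M * E                      ≡⟨ solve 2 (λ u v → u :- v := u :+ (:- con 1ℚ) :* v) refl (P * E) (M * E) ⟩
  P * E + - 1ℚ * (M * E)             ∎
  where
  open ℚ-Solver
  P = fromℕ ((m ℕ.* suc k) ^ q)
  M = fromℕ (m ^ q)
  I = inv^ (suc k) q
  E = eulerProduct q L
  cancel : P * I ≡ M
  cancel = begin
    P * I                              ≡⟨ cong (λ z → fromℕ z * I) (^-distribʳ-* m (suc k) q) ⟩
    fromℕ (m ^ q ℕ.* suc k ^ q) * I    ≡⟨ cong (_* I) (fromℕ-* (m ^ q) (suc k ^ q)) ⟩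
    M * fromℕ (suc k ^ q) * I          ≡⟨ ℚ.*-assoc M (fromℕ (suc k ^ q)) I ⟩
    M * (fromℕ (suc k ^ q) * I)        ≡⟨ cong (M *_) (fromℕ-*-1/ (suc k ^ q) {{ℕ.m^n≢0 (suc k) q}}) ⟩
    M * 1ℚ                             ≡⟨ ℚ.*-identityʳ M ⟩
    M                                  ∎

totientSum : List ℕ → ℕ → ℕ → ℚ
totientSum L n d = inv! (d ∸ 1) * Σ[1… d ] (λ i → fromℤ (s d i) * partialJ L (i ∸ 1) n)

totientSum-[] : ∀ n e .{{_ : NonZero n}} →
  totientSum [] n (suc e) ≡ fromℕ (length (compositions n (suc e)))
totientSum-[] n@(suc n-1) e = begin
  -- The trailing `1ℚ` is the empty Euler product.
  inv! e * Σ[1… suc e ] (λ i → fromℤ (s (suc e) i) * (fromℕ (n ^ (i ∸ 1)) * 1ℚ))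
    ≡⟨ cong (inv! e *_) (Σ-cong (suc e)
         (λ i → fromℤ (s (suc e) i) * (fromℕ (n ^ (i ∸ 1)) * 1ℚ))
         (λ i → fromℤ (s (suc e) i) * fromℕ (n ^ (i ∸ 1)))
         λ k → cong (fromℤ (s (suc e) (suc k)) *_) (ℚ.*-identityʳ (fromℕ (n ^ k)))) ⟩
  inv! e * stirlingSum (suc e) n
    ≡⟨ cong (inv! e *_) (!*#compositions≡stirlingSum n-1 e) ⟨
  inv! e * (fromℕ (e !) * c)
    ≡⟨ solve 3 (λ i f c → i :* (f :* c) := (f :* i) :* c) refl (inv! e) (fromℕ (e !)) c ⟩
  fromℕ (e !) * inv! e * c
    ≡⟨ cong (_* c) (fromℕ-*-1/ (e !) {{e ℕ.!≢0}}) ⟩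
  1ℚ * c
    ≡⟨ ℚ.*-identityˡ c ⟩
  c ∎
  where
  open ℚ-Solver
  c = fromℕ (length (compositions n (suc e)))

-- The sum is linear in the partial totients, so it inherits `partialJ-∷`. This matches the
-- recursion of the counts in `length-freeCompositions-∷`.
totientSum-∷ : ∀ k L m d →
  totientSum (k ∷ L) (m ℕ.* suc k) d ≡ totientSum L (m ℕ.* suc k) d + - 1ℚ * totientSum L m d
totientSum-∷ k L m d = begin
  c * Σ[1… d ] (λ i → σ i * partialJ (k ∷ L) (i ∸ 1) p)
    ≡⟨ cong (c *_) (Σ-cong d (λ i → σ i * partialJ (k ∷ L) (i ∸ 1) p) (λ i → f i + - 1ℚ * g i) λ j → trans
         (cong (σ (suc j) *_) (partialJ-∷ k L j m))
         (solve 3 (λ u v w → u :* (v :+ (:- con 1ℚ) :* w) := u :* v :+ (:- con 1ℚ) :* (u :* w)) refl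
           (σ (suc j)) (partialJ L j p) (partialJ L j m))) ⟩
  c * Σ[1… d ] (λ i → f i + - 1ℚ * g i)
    ≡⟨ cong (c *_) (sumℚ-+ (f ∘ suc) (λ j → - 1ℚ * g (suc j)) (upTo d)) ⟩
  c * (Σ[1… d ] f + Σ[1… d ] (λ i → - 1ℚ * g i))
    ≡⟨ cong (λ z → c * (Σ[1… d ] f + z)) (sumℚ-*ˡ (- 1ℚ) (g ∘ suc) (upTo d)) ⟩
  c * (Σ[1… d ] f + - 1ℚ * Σ[1… d ] g)
    ≡⟨ solve 3 (λ u v w → u :* (v :+ (:- con 1ℚ) :* w) := u :* v :+ (:- con 1ℚ) :* (u :* w)) refl
         c (Σ[1… d ] f) (Σ[1… d ] g) ⟩
  c * Σ[1… d ] f + - 1ℚ * (c * Σ[1… d ] g) ∎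
  where
  open ℚ-Solver
  p = m ℕ.* suc k
  c = inv! (d ∸ 1)
  σ f g : ℕ → ℚ
  σ i = fromℤ (s d i)
  f i = σ i * partialJ L (i ∸ 1) p
  g i = σ i * partialJ L (i ∸ 1) m

-- Induction on `L` with `n` varying: the hypothesis is needed both at `m ℕ.* suc k` and at `m`.
-- Hence `L` may be any list of distinct prime divisors of `n`, not necessarily all of them.
length-freeCompositions : ∀ L n e .{{_ : NonZero n}} →
  ListAll.All (PrimeDivisorOf n) L → Unique L →
  fromℕ (length (freeCompositions L n (suc e))) ≡ totientSum L n (suc e)
length-freeCompositions [] n e _ _ = trans
  (cong (fromℕ ∘ length) (List.filter-all (free? []) (ListAll.universal (λ _ → []) (compositions n (suc e)))))
  (sym (totientSum-[] n e))
length-freeCompositions (k ∷ L) _ e {{n≢0}} ((k-prime , divides m refl) ∷ primes) (k∉L ∷ L!) = begin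
  fromℕ c′                                 ≡⟨ solve 2 (λ u v → u := (u :+ v) :+ (:- con 1ℚ) :* v) refl (fromℕ c′) (fromℕ c) ⟩
  (fromℕ c′ + fromℕ c) + - 1ℚ * fromℕ c    ≡⟨ cong (_+ - 1ℚ * fromℕ c) (fromℕ-+ c′ c) ⟨
  fromℕ (c′ ℕ.+ c) + - 1ℚ * fromℕ c        ≡⟨ cong (λ z → fromℕ z + - 1ℚ * fromℕ c)
                                                (length-freeCompositions-∷ k L m (suc e) k-prime (ListAll.map proj₁ primes) k∉L) ⟨
  fromℕ (length (freeCompositions L (m ℕ.* suc k) (suc e))) + - 1ℚ * fromℕ c
    ≡⟨ cong₂ (λ u v → u + - 1ℚ * v)
         (length-freeCompositions L (m ℕ.* suc k) e primes L!)
         (length-freeCompositions L m e {{ℕ.m*n≢0⇒m≢0 m}} primes′ L!) ⟩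
  totientSum L (m ℕ.* suc k) (suc e) + - 1ℚ * totientSum L m (suc e)
    ≡⟨ totientSum-∷ k L m (suc e) ⟨
  totientSum (k ∷ L) (m ℕ.* suc k) (suc e) ∎
  where
  open ℚ-Solver
  c′ = length (freeCompositions (k ∷ L) (m ℕ.* suc k) (suc e))
  c  = length (freeCompositions L m (suc e))
  -- The remaining primes differ from `suc k`, so they still divide the quotient `m`.
  primes′ : ListAll.All (PrimeDivisorOf m) L
  primes′ = ListAll.zipWith
    (λ {j} ((j-prime , j∣n) , k≢j) → j-prime ,
      distinctPrimes⇒∣ m j-prime k-prime k≢j (subst (suc j ∣_) (ℕ.*-comm m (suc k)) j∣n))
    (primes , k∉L)

-- Primitive points

primeDivisors-1-sound : ∀ n → ListAll.All (PrimeDivisorOf n) (primeDivisors-1 n)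
primeDivisors-1-sound n = ListAll.all-filter _ (upTo n)

primeDivisors-1-unique : ∀ n → Unique (primeDivisors-1 n)
primeDivisors-1-unique n = Unique.filter⁺ _ (Unique.upTo⁺ n)

primeDivisors-1-complete : ∀ {n k} .{{_ : NonZero n}} → PrimeDivisorOf n k → k ∈ primeDivisors-1 n
-- The bound `suc k ≤ n` is by definition `k < n`, as membership in `upTo n` requires.
primeDivisors-1-complete pd@(_ , k∣n) = ∈-filter⁺ _ (∈-upTo⁺ (∣⇒≤ k∣n)) pd

no-primeDivisor⇒≡1 : ∀ n .{{_ : NonZero n}} → (∀ {p} → Prime p → p ∤ n) → n ≡ 1
no-primeDivisor⇒≡1 n h with factorise n
... | record { factors = [];     isFactorisation = eq } = eq
... | record { factors = p ∷ ps; isFactorisation = eq; factorsPrime = p-prime ∷ _ } =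
  contradiction (subst (p ∣_) (sym eq) (m∣m*n _)) (h p-prime)

-- The gcd divides the sum `n`, so it is nonzero and its prime divisors all occur in
-- `primeDivisors-1 n`; avoiding these leaves it no prime divisor at all.
free⇔gcdᵛ≡1 : ∀ n .{{_ : NonZero n}} (x : Vec ℕ d) → Vec.sum x ≡ n →
  Free (primeDivisors-1 n) x ⇔ gcdᵛ x ≡ 1
free⇔gcdᵛ≡1 n x sum≡n = mk⇔
  (λ free → no-primeDivisor⇒≡1 (gcdᵛ x) {{gcdᵛ≢0}} (prime∤ free))
  (λ gcd≡1 → ListAll.map (λ (p-prime , _) p∣x → ¬prime[1] (subst Prime (∣1⇒≡1 (subst (_ ∣_) gcd≡1 p∣x)) p-prime))
    (primeDivisors-1-sound n))
  where
  gcdᵛ∣n : gcdᵛ x ∣ n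
  gcdᵛ∣n = subst (gcdᵛ x ∣_) sum≡n (gcdᵛ∣sum x)
  prime∤ : Free (primeDivisors-1 n) x → ∀ {p} → Prime p → p ∤ gcdᵛ x
  prime∤ free {zero}  p-prime _   = ¬prime[0] p-prime
  prime∤ free {suc k} p-prime p∣x =
    ListAll.lookup free (primeDivisors-1-complete (p-prime , ∣-trans p∣x gcdᵛ∣n)) p∣x
  gcdᵛ≢0 : NonZero (gcdᵛ x)
  gcdᵛ≢0 = ℕ.≢-nonZero λ eq → ℕ.≢-nonZero⁻¹ n (0∣⇒≡0 (subst (_∣ n) eq gcdᵛ∣n))

toℤᵛ : Vec ℕ d → Vec ℤ d
toℤᵛ = Vec.map (λ n → + n)

content-toℤᵛ : ∀ (x : Vec ℕ d) → content (toℤᵛ x) ≡ + gcdᵛ x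
content-toℤᵛ []       = refl
content-toℤᵛ (x ∷ xs) = cong (λ z → + gcd x ∣ z ∣) (content-toℤᵛ xs)

‖toℤᵛ‖₁ : ∀ (x : Vec ℕ d) → ‖ toℤᵛ x ‖₁ ≡ Vec.sum x
‖toℤᵛ‖₁ []       = refl
‖toℤᵛ‖₁ (x ∷ xs) = cong (x ℕ.+_) (‖toℤᵛ‖₁ xs)

allPositive⇒toℤᵛ : ∀ {x : Vec ℤ d} → AllPositive x → ∃ λ y → x ≡ toℤᵛ y
allPositive⇒toℤᵛ []                     = [] , refl
-- Only `+<+` can prove `0ℤ < z`, and it exhibits `z` as `+ x`.
allPositive⇒toℤᵛ (ℤ.+<+ {n = x} _ ∷ pos) with allPositive⇒toℤᵛ pos
... | xs , refl = x ∷ xs , refl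

isCounted-toℤᵛ : ∀ (x : Vec ℕ d) →
  IsCounted n (toℤᵛ x) ⇔ (IsComposition n x × gcdᵛ x ≡ 1)
isCounted-toℤᵛ x = mk⇔
  (λ (prim , pos , norm) →
    (All.map ℤ.drop‿+<+ (All.map⁻ pos) , trans (sym (‖toℤᵛ‖₁ x)) norm) ,
    ℤ.+-injective (trans (sym (content-toℤᵛ x)) prim))
  (λ ((pos , sum≡n) , gcd≡1) →
    trans (content-toℤᵛ x) (cong (λ n → + n) gcd≡1) , All.map⁺ (All.map ℤ.+<+ pos) , trans (‖toℤᵛ‖₁ x) sum≡n)

-- `toℤᵛ` is a bijection from these free compositions to the counted points: positivity makes every
-- coordinate a natural number, and being primitive means having gcd 1.
cψ≡length-freeCompositions : ∀ n d .{{_ : NonZero n}} →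
  cψ n d ≡ length (freeCompositions (primeDivisors-1 n) n d)
cψ≡length-freeCompositions n d = begin
  length (countedPoints n d)
    ≡⟨ length-≡ (countedPoints-unique n d)
         (Unique.map⁺ (mapᵛ-injective ℤ.+-injective) (freeCompositions-unique L n d)) to-free from-free ⟩
  length (map toℤᵛ (freeCompositions L n d))
    ≡⟨ List.length-map toℤᵛ (freeCompositions L n d) ⟩
  length (freeCompositions L n d) ∎
  where
  open Equivalence
  L = primeDivisors-1 n
  to-free : ∀ {x} → x ∈ countedPoints n d → x ∈ map toℤᵛ (freeCompositions L n d)
  to-free x∈ with ∈-countedPoints .to x∈
  ... | counted@(_ , pos , _) with allPositive⇒toℤᵛ pos
  ...   | y , refl with isCounted-toℤᵛ y .to counted
  ...     | comp@(_ , sum≡n) , gcd≡1 =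
    ∈-map⁺ toℤᵛ (∈-freeCompositions L n .from (comp , free⇔gcdᵛ≡1 n y sum≡n .from gcd≡1))
  from-free : ∀ {x} → x ∈ map toℤᵛ (freeCompositions L n d) → x ∈ countedPoints n d
  from-free x∈ with ∈-map⁻ toℤᵛ x∈
  ... | y , y∈ , refl with ∈-freeCompositions L n .to y∈
  ...   | comp@(_ , sum≡n) , free =
    ∈-countedPoints .from (isCounted-toℤᵛ y .from (comp , free⇔gcdᵛ≡1 n y sum≡n .to free))

theorem2p4 : (p d : ℕ) .{{_ : NonZero p}} .{{_ : NonZero d}} →
    fromℕ (cψ p d) ≡ inv! (d ∸ 1) * Σ[1… d ] (λ i → fromℤ (s d i) * J (i ∸ 1) p)
theorem2p4 p d@(suc e) = trans
  (cong fromℕ (cψ≡length-freeCompositions p d))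
  -- For this list `partialJ` unfolds to `J`, so `totientSum` is the required right-hand side by
  -- definition.
  (length-freeCompositions (primeDivisors-1 p) p e (primeDivisors-1-sound p) (primeDivisors-1-unique p))
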